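{- (i) Let $q$ be a prime power, $n$ a positive integer, and $1\le i\le n-1$. If $\gamma\in\mathbb{F}_q$, then the polynomial $f(x)=x+\gamma\,\mathrm{Tr}_q^{q^n}\left(x^2-x^{q^i+1}\right)$ permutes $\mathbb{F}_{q^n}$. (ii) Let $q$ be an odd prime power and let $\gamma\in\mathbb{F}_{q^2}$. The polynomial $f(x)=x+\gamma\,\mathrm{Tr}_q^{q^2}\left(x^2-x^{q+1}\right)$ over $\mathbb{F}_{q^2}$ is a permutation polynomial if and only if $\gamma\in\mathbb{F}_q$.
   Context: $\mathrm{Tr}_q^{q^n}:\mathbb{F}_{q^n}\to\mathbb{F}_q$ is the trace map $\mathrm{Tr}_q^{q^n}(x)=x+x^q+\cdots+x^{q^{n-1}}$. A polynomial $f$ over a finite field is a permutation polynomial (permutes the field) if the map $x\mapsto f(x)$ is a bijection of the field onto itself. -}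

module Defs where

open import Level using (Level; _⊔_; suc)
open import Data.Nat as ℕ using (ℕ; _≤_)
open import Data.Nat.Primality using (Prime)
open import Data.Fin using (Fin; toℕ)
open import Data.Product using (∃; ∃₂; _×_)
open import Relation.Binary.PropositionalEquality as ≡ using (_≡_)
open import Relation.Binary.Bundles using (Setoid)
open import Function.Bundles using (Inverse)
open import Function.Definitions using (Bijective)
open import Algebra.Bundles using (CommutativeRing)
open import Algebra.Apartness.Bundles using (HeytingField; HeytingCommutativeRing)
open import Algebra.Morphism.Structures using (module RingMorphisms)
import Algebra.Properties.Semiring.Exp as Exp
import Algebra.Properties.CommutativeMonoid.Sum as Sum

IsPrimePower : ℕ → Set
IsPrimePower q = ∃₂ λ p k → Prime p × 1 ≤ k × q ≡ p ℕ.^ k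

HasCardinality : ∀ {c ℓ} → Setoid c ℓ → ℕ → Set (c ⊔ ℓ)
HasCardinality S m = Inverse S (≡.setoid (Fin m))

fieldRing : ∀ {c ℓ₁ ℓ₂} → HeytingField c ℓ₁ ℓ₂ → CommutativeRing c ℓ₁
fieldRing K = HeytingCommutativeRing.commutativeRing (HeytingField.heytingCommutativeRing K)

-- A model of 𝔽_q ⊆ 𝔽_{q^n}: fields with q and q^n elements and a ring
-- homomorphism between them, which is injective because its domain is a
-- field.  On a finite setoid equality is decidable and the (tight) apartness
-- of a Heyting field is the negation of _≈_, so these are exactly the usual
-- finite fields.
record FiniteFieldExtension (q n : ℕ) (a ℓa ra b ℓb rb : Level)
    : Set (suc (a ⊔ ℓa ⊔ ra ⊔ b ⊔ ℓb ⊔ rb)) where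
  field
    baseField : HeytingField a ℓa ra
    topField  : HeytingField b ℓb rb

  private
    module F = CommutativeRing (fieldRing baseField)
  open CommutativeRing (fieldRing topField) public
  open RingMorphisms F.rawRing rawRing using (IsRingHomomorphism)

  field
    base-cardinality         : HasCardinality F.setoid q
    top-cardinality          : HasCardinality setoid (q ℕ.^ n)
    embed                    : F.Carrier → Carrier
    embed-isRingHomomorphism : IsRingHomomorphism embed

  open Exp semiring public using (_^_)

  InBaseField : Carrier → Set (a ⊔ ℓb)
  InBaseField x = ∃ λ c → embed c ≈ x

  -- The trace as an element of the top field: x + x^q + ⋯ + x^(q^(n-1)).
  Tr : Carrier → Carrier
  Tr x = Sum.sum +-commutativeMonoid {n} λ j → x ^ (q ℕ.^ toℕ j)

  -- Applied to the evaluation map of a polynomial.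
  Permutes : (Carrier → Carrier) → Set (b ⊔ ℓb)
  Permutes f = Bijective _≈_ _≈_ f

{-# OPTIONS --safe #-}
module Submission where

-- Let T(x) = Tr(x² - x^(q^i+1)) = Tr(x (x - x^(q^i))).  If c^q = c, then
-- T(x + c) = T(x) + c Tr(x - x^(q^i)) = T(x), because c cancels in the second factor and
-- Tr is invariant under the Frobenius map.  Since γ T(y) is such a c for γ ∈ 𝔽_q, the
-- map y ↦ y - γ T(y) inverts f.  For n = 2 and i = 1 one has T(x) = (x - x^q)²; if
-- w = γ - γ^q is nonzero, then s = -w⁻² lies in 𝔽_q and f(γ s) = γ (s + w² s²) = 0 = f(0),
-- although γ s ≠ 0.  That 𝔽_q consists of all the solutions of x^q = x is root counting.

open import Defs
open import Data.Nat as ℕ using (ℕ; _≤_; _∸_)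
open import Data.Nat.Divisibility using (_∣_)
open import Data.Product using (_×_)
open import Function.Bundles using (_⇔_)
open import Relation.Nullary using (¬_)

open import Level using (_⊔_)
open import Algebra.Bundles using (CommutativeRing)
open import Algebra.Apartness.Bundles using (HeytingField)
import Algebra.Apartness.Properties.HeytingCommutativeRing as HeytingProperties
open import Algebra.Morphism.Structures using (module RingMorphisms)
import Algebra.Properties.CommutativeMonoid.Sum as Sum
import Algebra.Properties.CommutativeSemiring.Binomial as Binomial
import Algebra.Properties.CommutativeSemiring.Exp as Exp
import Algebra.Properties.Ring as RingProperties
import Algebra.Properties.Semiring.Mult as Mult
import Algebra.Properties.Semiring.Sum as SemiringSum
import Algebra.Properties.CommutativeSemigroup as CommutativeSemigroupProperties
open import Data.Fin as Fin using (Fin; zero; suc; toℕ; punchIn; fromℕ; inject₁)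
open import Data.Fin.Permutation as Perm using (Permutation; _⟨$⟩ʳ_)
open import Data.Fin.Properties as Finₚ
  using (any?; punchInᵢ≢i; toℕ-fromℕ; toℕ-inject₁; toℕ<n)
open import Data.Nat using (zero; suc; _!; NonZero; s≤s; z≤n)
open import Data.Nat.Combinatorics using (_C_; nCn≡1; nCk≡n!/k![n-k]!; k![n∸k]!∣n!)
open import Data.Nat.DivMod using (m/n*n≡m)
open import Data.Nat.Divisibility using (∣⇒≤; m∣m*n; quotient; m∣n⇒n≡m*quotient)
open import Data.Nat.Primality
  using (Prime; euclidsLemma; prime⇒nonZero; prime⇒nonTrivial)
import Data.Nat.Properties as ℕₚ
open import Data.Nat.Properties using (_!*_!≢0)
open import Data.Product using (∃; _,_; proj₁)
open import Data.Sum using (_⊎_; inj₁; inj₂; [_,_]′)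
open import Data.Vec using (Vec; []; _∷_; replicate)
open import Function using (_∘_)
open import Function.Bundles using (Inverse; mk⇔)
import Function.Construct.Composition as Composition
import Function.Construct.Symmetry as Symmetry
import Function.Consequences.Setoid as Consequences
open import Function.Definitions using (Injective; Congruent)
open import Relation.Binary.Definitions using (Decidable)
open import Relation.Binary.PropositionalEquality as ≡ using (_≡_)
import Relation.Binary.Reasoning.Setoid as ≈-Reasoning
open import Relation.Nullary using (yes; no; contradiction)
open import Relation.Nullary.Decidable using (map′)

-- Primes dividing factorials and binomial coefficients.

prime∣!⇒≤ : ∀ {p} → Prime p → ∀ k → p ∣ k ! → p ≤ k
prime∣!⇒≤ pr zero    p∣1 = contradiction (∣⇒≤ p∣1) (ℕₚ.<⇒≱ (ℕ.nonTrivial⇒n>1 _))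
  where instance _ = prime⇒nonTrivial pr
prime∣!⇒≤ pr (suc k) p∣k! =
  [ ∣⇒≤ , ℕₚ.m≤n⇒m≤1+n ∘ prime∣!⇒≤ pr k ]′ (euclidsLemma (suc k) (k !) pr p∣k!)

-- `p` divides `p !`, which is `p C k` times `k ! * (p ∸ k) !`. By Euclid's lemma it divides one of
-- the three factors, and neither factorial qualifies because both `k` and `p ∸ k` are smaller than
-- `p`.
prime∣C : ∀ {p k} → Prime p → 1 ≤ k → k ℕ.< p → p ∣ p C k
prime∣C {p} {k} pr 1≤k k<p with euclidsLemma (p C k) (k ! ℕ.* (p ∸ k) !) pr p∣product
  where
  instance
    _ = k !* (p ∸ k) !≢0
    _ = prime⇒nonZero pr
  product≡p! : (p C k) ℕ.* (k ! ℕ.* (p ∸ k) !) ≡ p !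
  product≡p! = ≡.trans
    (≡.cong (ℕ._* (k ! ℕ.* (p ∸ k) !)) (nCk≡n!/k![n-k]! (ℕₚ.<⇒≤ k<p)))
    (m/n*n≡m (k![n∸k]!∣n! (ℕₚ.<⇒≤ k<p)))
  p∣p! : ∀ p → .{{NonZero p}} → p ∣ p !
  p∣p! (suc p) = m∣m*n (p !)
  p∣product : p ∣ (p C k) ℕ.* (k ! ℕ.* (p ∸ k) !)
  p∣product = ≡.subst (p ∣_) (≡.sym product≡p!) (p∣p! p)
... | inj₁ p∣C = p∣C
... | inj₂ p∣k![p-k]! with euclidsLemma (k !) ((p ∸ k) !) pr p∣k![p-k]!
...   | inj₁ p∣k! = contradiction (prime∣!⇒≤ pr k p∣k!) (ℕₚ.<⇒≱ k<p)
...   | inj₂ p∣[p-k]! =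
  contradiction (prime∣!⇒≤ pr (p ∸ k) p∣[p-k]!)
                (ℕₚ.<⇒≱ (ℕₚ.∸-monoʳ-< 1≤k (ℕₚ.<⇒≤ k<p)))

-- Additive power maps and the Frobenius map in characteristic `p`.

module AdditivePowers {c ℓ} (R : CommutativeRing c ℓ) where

  open CommutativeRing R hiding (zero)
  open RingProperties ring
  open Exp commutativeSemiring
  open Mult semiring renaming (_×_ to _·_)
  open Sum +-commutativeMonoid
  open ≈-Reasoning setoid

  -- Wrapped in a record so that unification can read the exponent off the type of a proof.
  record Additive (m : ℕ) : Set (c ⊔ ℓ) where
    field ^-distrib-+ : ∀ x y → (x + y) ^ m ≈ x ^ m + y ^ m

  open Additive public

  additive-1 : Additive 1
  additive-1 .^-distrib-+ = distribʳ 1#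

  additive-* : ∀ {m n} → Additive m → Additive n → Additive (m ℕ.* n)
  additive-* {m} {n} am an .^-distrib-+ x y = begin
    (x + y) ^ (m ℕ.* n)           ≈⟨ ^-assocʳ (x + y) m n ⟨
    ((x + y) ^ m) ^ n             ≈⟨ ^-congˡ n (^-distrib-+ am x y) ⟩
    (x ^ m + y ^ m) ^ n           ≈⟨ ^-distrib-+ an (x ^ m) (y ^ m) ⟩
    (x ^ m) ^ n + (y ^ m) ^ n     ≈⟨ +-cong (^-assocʳ x m n) (^-assocʳ y m n) ⟩
    x ^ (m ℕ.* n) + y ^ (m ℕ.* n) ∎

  additive-^ : ∀ {m} → Additive m → ∀ k → Additive (m ℕ.^ k)
  additive-^ am zero    = additive-1
  additive-^ am (suc k) = additive-* am (additive-^ am k)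

  0^ : ∀ {m} → Additive m → 0# ^ m ≈ 0#
  0^ {m} am = x+x≈x⇒x≈0 (0# ^ m)
    (trans (sym (^-distrib-+ am 0# 0#)) (^-congˡ m (+-identityˡ 0#)))

  -‿^ : ∀ {m} → Additive m → ∀ x → (- x) ^ m ≈ - (x ^ m)
  -‿^ {m} am x = +-inverseˡ-unique ((- x) ^ m) (x ^ m) (begin
    (- x) ^ m + x ^ m ≈⟨ ^-distrib-+ am (- x) x ⟨
    (- x + x) ^ m     ≈⟨ ^-congˡ m (-‿inverseˡ x) ⟩
    0# ^ m            ≈⟨ 0^ am ⟩
    0#                ∎)

  sum-^ : ∀ {m} → Additive m → ∀ {n} (t : Fin n → Carrier) → sum t ^ m ≈ sum (λ i → t i ^ m)
  sum-^ am {zero}  t = 0^ am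
  sum-^ am {suc n} t = trans (^-distrib-+ am (t zero) (sum (t ∘ suc))) (+-congˡ (sum-^ am (t ∘ suc)))

  ∣⇒·≈0 : ∀ {m n} → m · 1# ≈ 0# → m ∣ n → ∀ x → n · x ≈ 0#
  ∣⇒·≈0 {m} {n} m·1≈0 m∣n x = begin
    n · x                          ≡⟨ ≡.cong (_· x) (m∣n⇒n≡m*quotient m∣n) ⟩
    (m ℕ.* quotient m∣n) · x       ≈⟨ ×-assocˡ x m (quotient m∣n) ⟨
    m · (quotient m∣n · x)         ≈⟨ ×-congʳ m (*-identityˡ _) ⟨
    m · (1# * (quotient m∣n · x))  ≈⟨ ×-assoc-* m 1# _ ⟨
    (m · 1#) * (quotient m∣n · x)  ≈⟨ *-congʳ m·1≈0 ⟩
    0# * (quotient m∣n · x)        ≈⟨ zeroˡ _ ⟩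
    0#                             ∎

  -- The inner binomial coefficients are divisible by `p`, so only the two outer terms of the
  -- expansion survive. Writing `p` as `suc m` splits its `p + 1` terms into the first, `m` middle
  -- ones and the last.
  additive-prime : ∀ {p} → Prime p → p · 1# ≈ 0# → Additive p
  additive-prime {suc m} pr p·1≈0 .^-distrib-+ x y = begin
    (x + y) ^ p                                  ≈⟨ Binomial.theorem commutativeSemiring p x y ⟩
    term zero + sum (term ∘ suc)                 ≈⟨ +-cong first (sum-init-last (term ∘ suc)) ⟩
    y ^ p + (sum {m} middle + term (fromℕ p))    ≈⟨ +-congˡ (+-cong middle≈0 last) ⟩
    y ^ p + (0# + x ^ p)                         ≈⟨ +-congˡ (+-identityˡ (x ^ p)) ⟩
    y ^ p + x ^ p                                ≈⟨ +-comm (y ^ p) (x ^ p) ⟩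
    x ^ p + y ^ p                                ∎
    where
    p = suc m

    term : Fin (suc p) → Carrier
    term = Binomial.binomialTerm commutativeSemiring x y p

    middle : Fin m → Carrier
    middle j = term (suc (inject₁ j))

    first : term zero ≈ y ^ p
    first = trans (×-homo-1 _) (*-identityˡ (y ^ p))

    last : term (fromℕ p) ≈ x ^ p
    last = begin
      (p C toℕ (fromℕ p)) · (x ^ toℕ (fromℕ p) * y ^ (p ∸ toℕ (fromℕ p)))
        ≡⟨ ≡.cong (λ k → (p C k) · (x ^ k * y ^ (p ∸ k))) (toℕ-fromℕ p) ⟩
      (p C p) · (x ^ p * y ^ (p ∸ p))
        ≡⟨ ≡.cong₂ (λ a b → a · (x ^ p * y ^ b)) (nCn≡1 p) (ℕₚ.n∸n≡0 p) ⟩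
      1 · (x ^ p * 1#)
        ≈⟨ ×-homo-1 _ ⟩
      x ^ p * 1#
        ≈⟨ *-identityʳ (x ^ p) ⟩
      x ^ p ∎

    middle≈0 : sum {m} middle ≈ 0#
    middle≈0 = trans (sum-cong-≋ {m} {middle} λ j →
      ∣⇒·≈0 p·1≈0 (prime∣C {k = toℕ (suc (inject₁ j))} pr (s≤s z≤n)
        (≡.subst (ℕ._< p) (≡.cong suc (≡.sym (toℕ-inject₁ j))) (s≤s (toℕ<n j)))) _)
      (sum-replicate-zero m)

-- Finite fields: decidable equality, units and characteristic.

module FiniteField {c ℓ₁ ℓ₂} (K : HeytingField c ℓ₁ ℓ₂) {m}
  (card : HasCardinality (CommutativeRing.setoid (fieldRing K)) m) where

  open HeytingField K using (_#_; tight; #⇒invertible; #-irrefl)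
  open CommutativeRing (fieldRing K) hiding (zero)
  open RingProperties ring
  open Exp commutativeSemiring
  open Mult semiring using (×1-homo-*) renaming (_×_ to _·_)
  open ≈-Reasoning setoid
  open Inverse card using (to; from; to-cong; strictlyInverseˡ; strictlyInverseʳ)
  private module Heyting = HeytingProperties (HeytingField.heytingCommutativeRing K)

  to-injective : ∀ {x y} → to x ≡ to y → x ≈ y
  to-injective {x} {y} eq =
    trans (sym (strictlyInverseʳ x)) (trans (reflexive (≡.cong from eq)) (strictlyInverseʳ y))

  from-injective : Injective _≡_ _≈_ from
  from-injective {i} {j} eq =
    ≡.trans (≡.sym (strictlyInverseˡ i)) (≡.trans (to-cong eq) (strictlyInverseˡ j))

  infix 4 _≟_
  _≟_ : Decidable _≈_
  x ≟ y = map′ to-injective to-cong (to x Finₚ.≟ to y)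

  1≉0 : ¬ (1# ≈ 0#)
  1≉0 1≈0 = #-irrefl 1≈0 Heyting.1#0

  -- An exhaustive search decides whether `x` has an inverse. If it has none, `x` cannot be apart
  -- from `0#`, and tightness turns this into equality.
  zero-or-unit : ∀ x → x ≈ 0# ⊎ ∃ λ y → x * y ≈ 1#
  zero-or-unit x with any? (λ i → x * from i ≟ 1#)
  ... | yes (i , xy≈1) = inj₂ (from i , xy≈1)
  ... | no ¬unit = inj₁ (proj₁ (tight x 0#) λ x#0 →
    let y , _ , x-0*y≈1 = #⇒invertible x#0
    in ¬unit (to y , (begin
      x * from (to y) ≈⟨ *-congˡ (strictlyInverseʳ y) ⟩
      x * y           ≈⟨ *-congʳ (Heyting.x-0≈x x) ⟨
      (x - 0#) * y    ≈⟨ x-0*y≈1 ⟩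
      1#              ∎)))

  unit-cancelˡ : ∀ {x y z w} → y * x ≈ 1# → x * z ≈ x * w → z ≈ w
  unit-cancelˡ {x} {y} {z} {w} yx≈1 xz≈xw = begin
    z           ≈⟨ strip z ⟨
    y * (x * z) ≈⟨ *-congˡ xz≈xw ⟩
    y * (x * w) ≈⟨ strip w ⟩
    w           ∎
    where
    strip : ∀ v → y * (x * v) ≈ v
    strip v = begin
      y * (x * v) ≈⟨ *-assoc y x v ⟨
      (y * x) * v ≈⟨ *-congʳ yx≈1 ⟩
      1# * v      ≈⟨ *-identityˡ v ⟩
      v           ∎

  *-cancelˡ-≉0 : ∀ {x z w} → ¬ (x ≈ 0#) → x * z ≈ x * w → z ≈ w
  *-cancelˡ-≉0 {x} x≉0 eq with zero-or-unit x
  ... | inj₁ x≈0        = contradiction x≈0 x≉0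
  ... | inj₂ (y , xy≈1) = unit-cancelˡ (trans (*-comm y x) xy≈1) eq

  integral : ∀ {x y} → x * y ≈ 0# → ¬ (x ≈ 0#) → y ≈ 0#
  integral {x} xy≈0 x≉0 = *-cancelˡ-≉0 x≉0 (trans xy≈0 (sym (zeroʳ x)))

  ^≈0⇒≈0 : ∀ {x} n → x ^ n ≈ 0# → x ≈ 0#
  ^≈0⇒≈0 zero 1≈0 = contradiction 1≈0 1≉0
  ^≈0⇒≈0 {x} (suc n) x*xⁿ≈0 with x ≟ 0#
  ... | yes x≈0 = x≈0
  ... | no  x≉0 = ^≈0⇒≈0 n (integral x*xⁿ≈0 x≉0)

  -- Adding `1#` permutes the field, so the sum of all elements is unchanged when each of its `m`
  -- terms grows by `1#`.
  card·1≈0 : m · 1# ≈ 0#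
  card·1≈0 = +-identityʳ-unique (sum from) (m · 1#) (begin
    sum from + m · 1#                    ≈⟨ +-congˡ (sum-replicate m) ⟨
    sum from + sum {m} (λ _ → 1#)        ≈⟨ ∑-distrib-+ from (λ _ → 1#) ⟨
    sum (λ i → from i + 1#)              ≈⟨ sum-cong-≋ (λ i → strictlyInverseʳ (from i + 1#)) ⟨
    sum (λ i → from (shift ⟨$⟩ʳ i))      ≈⟨ sum-permute from shift ⟨
    sum from                             ∎)
    where
    open Sum +-commutativeMonoid

    _+1 : Inverse setoid setoid
    _+1 = record
      { to        = _+ 1#
      ; from      = _- 1#
      ; to-cong   = +-congʳ
      ; from-cong = +-congʳ
      ; inverse   = (λ {x} eq → trans (+-congʳ eq) (//-rightDividesˡ 1# x))
                  , (λ {x} eq → trans (+-congʳ eq) (//-rightDividesʳ 1# x))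
      }

    shift : Permutation m m
    shift = Composition.inverse (Symmetry.inverse card) (Composition.inverse _+1 card)

  -- `m · 1#` is the `k`-th power of `p · 1#`, and a field has no nonzero nilpotent elements.
  prime-characteristic : ∀ {p} k → m ≡ p ℕ.^ k → p · 1# ≈ 0#
  prime-characteristic {p} k ≡.refl = ^≈0⇒≈0 k (trans (sym (pᵏ·1 k)) card·1≈0)
    where
    pᵏ·1 : ∀ k → (p ℕ.^ k) · 1# ≈ (p · 1#) ^ k
    pᵏ·1 zero    = +-identityʳ 1#
    pᵏ·1 (suc k) = trans (×1-homo-* p (p ℕ.^ k)) (*-congˡ (pᵏ·1 k))

-- Fermat's identity `x ^ m = x` in a field with `m` elements.

-- Multiplication by a unit permutes the nonzero elements, so it fixes their product.
module _ {c ℓ₁ ℓ₂} (K : HeytingField c ℓ₁ ℓ₂) where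

  open CommutativeRing (fieldRing K) hiding (zero)
  open Exp commutativeSemiring
  open Sum *-commutativeMonoid
    renaming (sum to product; sum-cong-≋ to product-cong; sum-permute to product-permute;
              sum-replicate to product-replicate; ∑-distrib-+ to product-distrib)
  open ≈-Reasoning setoid

  unit^k≈1 : ∀ {k} → HasCardinality setoid (suc k) → ∀ {x y} → x * y ≈ 1# → x ^ k ≈ 1#
  unit^k≈1 {k} card {x} {y} xy≈1 = *-cancelˡ-≉0 (product≉0 nonzero nonzero≉0) (begin
    product nonzero * x ^ k                  ≈⟨ *-comm _ _ ⟩
    x ^ k * product nonzero                  ≈⟨ *-congʳ (product-replicate k) ⟨
    product {k} (λ _ → x) * product nonzero  ≈⟨ product-distrib (λ _ → x) nonzero ⟨
    product (λ j → x * nonzero j)            ≈⟨ product-cong scale-nonzero ⟨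
    product (λ j → nonzero (scale′ ⟨$⟩ʳ j))  ≈⟨ product-permute nonzero scale′ ⟨
    product nonzero                          ≈⟨ *-identityʳ _ ⟨
    product nonzero * 1#                     ∎)
    where
    open FiniteField K card
    open Inverse card using (to; from; to-cong; strictlyInverseˡ; strictlyInverseʳ)

    nonzero : Fin k → Carrier
    nonzero j = from (punchIn (to 0#) j)

    nonzero≉0 : ∀ j → ¬ (nonzero j ≈ 0#)
    nonzero≉0 j eq = punchInᵢ≢i (to 0#) j
      (≡.trans (≡.sym (strictlyInverseˡ _)) (to-cong eq))

    product≉0 : ∀ {n} (t : Fin n → Carrier) → (∀ i → ¬ (t i ≈ 0#)) → ¬ (product t ≈ 0#)
    product≉0 {zero}  t t≉0 = 1≉0
    product≉0 {suc n} t t≉0 eq =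
      product≉0 (t ∘ suc) (t≉0 ∘ suc) (integral eq (t≉0 zero))

    cancel : ∀ {u v} → u * v ≈ 1# → ∀ z {w} → w ≈ v * z → u * w ≈ z
    cancel {u} {v} uv≈1 z {w} eq = begin
      u * w       ≈⟨ *-congˡ eq ⟩
      u * (v * z) ≈⟨ *-assoc u v z ⟨
      (u * v) * z ≈⟨ *-congʳ uv≈1 ⟩
      1# * z      ≈⟨ *-identityˡ z ⟩
      z           ∎

    scaling : Inverse setoid setoid
    scaling = record
      { to        = x *_
      ; from      = y *_
      ; to-cong   = *-congˡ
      ; from-cong = *-congˡ
      ; inverse   = cancel xy≈1 _ , cancel (trans (*-comm y x) xy≈1) _
      }

    scale : Permutation (suc k) (suc k)
    scale = Composition.inverse (Symmetry.inverse card) (Composition.inverse scaling card)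

    scale-zero : scale ⟨$⟩ʳ to 0# ≡ to 0#
    scale-zero = to-cong (trans (*-congˡ (strictlyInverseʳ 0#)) (zeroʳ x))

    scale′ : Permutation k k
    scale′ = Perm.remove (to 0#) scale

    scale-nonzero : ∀ j → nonzero (scale′ ⟨$⟩ʳ j) ≈ x * nonzero j
    scale-nonzero j = begin
      from (punchIn (to 0#) (scale′ ⟨$⟩ʳ j))
        -- `Perm.punchIn-permute` skips the image of the removed index; `scale-zero` identifies that
        -- image with `to 0#`, the index that `nonzero` skips.
        ≡⟨ ≡.cong (λ i → from (punchIn i (scale′ ⟨$⟩ʳ j))) scale-zero ⟨
      from (punchIn (scale ⟨$⟩ʳ to 0#) (scale′ ⟨$⟩ʳ j))
        ≡⟨ ≡.cong from (Perm.punchIn-permute scale (to 0#) j) ⟨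
      from (scale ⟨$⟩ʳ punchIn (to 0#) j)
        ≈⟨ strictlyInverseʳ _ ⟩
      x * nonzero j ∎

  fermat : ∀ {m} → HasCardinality setoid m → ∀ x → x ^ m ≈ x
  fermat {zero}  card x = contradiction (Inverse.to card x) Finₚ.¬Fin0
  fermat {suc k} card x with FiniteField.zero-or-unit K card x
  ... | inj₁ x≈0 = trans (*-congʳ x≈0) (trans (zeroˡ _) (sym x≈0))
  ... | inj₂ (y , xy≈1) = trans (*-congˡ (unit^k≈1 card xy≈1)) (*-identityʳ x)

-- Root counting for monic polynomials.

module MonicPolynomials {c ℓ₁ ℓ₂} (K : HeytingField c ℓ₁ ℓ₂) {m}
  (card : HasCardinality (CommutativeRing.setoid (fieldRing K)) m) where

  open FiniteField K card
  open CommutativeRing (fieldRing K) hiding (zero)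
  open RingProperties ring
  open Exp commutativeSemiring
  open CommutativeSemigroupProperties *-commutativeSemigroup using (x∙yz≈y∙xz)
  open ≈-Reasoning setoid

  -- The vector c₀ ∷ … ∷ c_{d-1} stands for c₀ + c₁ x + ⋯ + c_{d-1} x^{d-1} + x^d.
  eval : ∀ {d} → Vec Carrier d → Carrier → Carrier
  eval []       x = 1#
  eval (c ∷ cs) x = c + x * eval cs x

  -- Synthetic division by `X - r`: the Horner values at `r` of the successive tails are the
  -- coefficients of the quotient, which is again monic with implicit leading coefficient.
  quot : ∀ {d} → Vec Carrier (suc d) → Carrier → Vec Carrier d
  quot (_ ∷ [])         r = []
  quot (_ ∷ cs@(_ ∷ _)) r = eval cs r ∷ quot cs r

  +-difference : ∀ x y → x ≈ y + (x - y)
  +-difference x y = sym (trans (+-comm y (x - y)) (//-rightDividesˡ y x))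

  -- Division with remainder, by induction along Horner's scheme. After the induction hypothesis is
  -- inserted, only the `x` in front of `e` is split as `r + (x - r)`; the other one moves behind
  -- the factor `x - r`.
  eval-quot : ∀ {d} (cs : Vec Carrier (suc d)) r x →
              eval cs x ≈ eval cs r + (x - r) * eval (quot cs r) x
  eval-quot (c ∷ []) r x = begin
    c + x * 1#                    ≈⟨ +-congˡ (*-congʳ (+-difference x r)) ⟩
    c + (r + (x - r)) * 1#        ≈⟨ +-congˡ (distribʳ 1# r (x - r)) ⟩
    c + (r * 1# + (x - r) * 1#)   ≈⟨ +-assoc _ _ _ ⟨
    c + r * 1# + (x - r) * 1#     ∎
  eval-quot (c ∷ cs@(_ ∷ _)) r x = begin
    c + x * eval cs x                            ≈⟨ +-congˡ (*-congˡ (eval-quot cs r x)) ⟩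
    c + x * (e + (x - r) * h)                    ≈⟨ +-congˡ (distribˡ x e _) ⟩
    c + (x * e + x * ((x - r) * h))              ≈⟨ +-congˡ (+-cong (*-congʳ (+-difference x r)) (x∙yz≈y∙xz x (x - r) h)) ⟩
    c + ((r + (x - r)) * e + (x - r) * (x * h))  ≈⟨ +-congˡ (+-congʳ (distribʳ e r (x - r))) ⟩
    c + (r * e + (x - r) * e + (x - r) * (x * h)) ≈⟨ +-congˡ (+-assoc _ _ _) ⟩
    c + (r * e + ((x - r) * e + (x - r) * (x * h))) ≈⟨ +-assoc _ _ _ ⟨
    c + r * e + ((x - r) * e + (x - r) * (x * h)) ≈⟨ +-congˡ (distribˡ (x - r) e (x * h)) ⟨
    c + r * e + (x - r) * (e + x * h)            ∎
    where
    e = eval cs r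
    h = eval (quot cs r) x

  -- Dividing out the root `r zero` keeps the remaining roots, as they differ from it and the field
  -- has no zero divisors. The descent ends at the constant polynomial 1, which has no root.
  too-many-roots : ∀ {d} (cs : Vec Carrier d) (r : Fin (suc d) → Carrier) →
                   Injective _≡_ _≈_ r → ¬ (∀ i → eval cs (r i) ≈ 0#)
  too-many-roots []           r r-inj root = 1≉0 (root zero)
  too-many-roots cs@(_ ∷ _) r r-inj root =
    too-many-roots (quot cs r₀) (r ∘ suc) (Finₚ.suc-injective ∘ r-inj) λ i →
      integral
        (begin
          (r (suc i) - r₀) * eval (quot cs r₀) (r (suc i))              ≈⟨ +-identityˡ _ ⟨
          0# + (r (suc i) - r₀) * eval (quot cs r₀) (r (suc i))         ≈⟨ +-congʳ (root zero) ⟨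
          eval cs r₀ + (r (suc i) - r₀) * eval (quot cs r₀) (r (suc i)) ≈⟨ eval-quot cs r₀ (r (suc i)) ⟨
          eval cs (r (suc i))                                           ≈⟨ root (suc i) ⟩
          0#                                                            ∎)
        (λ eq → contradiction (r-inj (x∙y⁻¹≈ε⇒x≈y _ _ eq)) λ ())
    where
    r₀ = r zero

  eval-replicate-0 : ∀ d x → eval (replicate d 0#) x ≈ x ^ d
  eval-replicate-0 zero    x = refl
  eval-replicate-0 (suc d) x = trans (+-identityˡ _) (*-congˡ (eval-replicate-0 d x))

  too-many-fixed-points : ∀ {q} → 2 ≤ q → (r : Fin (suc q) → Carrier) →
                          Injective _≡_ _≈_ r → ¬ (∀ i → r i ^ q ≈ r i)
  too-many-fixed-points {suc (suc d)} (s≤s (s≤s _)) r r-inj fixed =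
    -- The vector encodes `X^q - X`. With `q = d + 2` the `d` zeros fill the degrees from 2 to
    -- `q - 1`, and the leading 1 is implicit.
    too-many-roots (0# ∷ - 1# ∷ replicate d 0#) r r-inj λ i →
      let x = r i in begin
      0# + x * (- 1# + x * eval (replicate d 0#) x) ≈⟨ +-identityˡ _ ⟩
      x * (- 1# + x * eval (replicate d 0#) x)      ≈⟨ *-congˡ (+-congˡ (*-congˡ (eval-replicate-0 d x))) ⟩
      x * (- 1# + x ^ suc d)                        ≈⟨ distribˡ x (- 1#) (x ^ suc d) ⟩
      x * - 1# + x ^ suc (suc d)                    ≈⟨ +-cong (sym (-‿distribʳ-* x 1#)) (fixed i) ⟩
      - (x * 1#) + x                                ≈⟨ +-congʳ (-‿cong (*-identityʳ x)) ⟩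
      - x + x                                       ≈⟨ -‿inverseˡ x ⟩
      0#                                            ∎

primePower⇒2≤ : ∀ {q} → IsPrimePower q → 2 ≤ q
primePower⇒2≤ (p , suc k , pr , _ , ≡.refl) =
  ℕₚ.≤-trans (ℕ.nonTrivial⇒n>1 p) (ℕₚ.m≤m*n p (p ℕ.^ k))
  where
  instance
    _ = prime⇒nonTrivial pr
    _ = prime⇒nonZero pr
    _ = ℕₚ.m^n≢0 p k

-- The base field inside the extension, and the trace.

module TraceProperties {a ℓa ra b ℓb rb} {q n : ℕ} (q-primePower : IsPrimePower q)
  (E : FiniteFieldExtension q n a ℓa ra b ℓb rb) where

  private
    module F where
      open FiniteFieldExtension E using (baseField; base-cardinality)
      open CommutativeRing (fieldRing baseField) public
      open RingProperties ring public
      open Exp commutativeSemiring public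
      open FiniteField baseField base-cardinality public
      open Inverse base-cardinality public using (from)

  open FiniteFieldExtension E hiding (zero; _^_)
  open RingProperties ring
  open Exp commutativeSemiring
  open SemiringSum semiring using (sum; sum-cong-≋; ∑-distrib-+; *-distribˡ-sum)
  open CommutativeSemigroupProperties +-commutativeSemigroup using (interchange)
  open AdditivePowers (fieldRing topField)
  open FiniteField topField top-cardinality
  open MonicPolynomials topField top-cardinality using (too-many-fixed-points)
  open ≈-Reasoning setoid
  open RingMorphisms F.rawRing rawRing using (module IsRingHomomorphism)
  open IsRingHomomorphism embed-isRingHomomorphism
    renaming (⟦⟧-cong to embed-cong)

  -- The top field has `p ^ (k * n)` elements, so its characteristic is `p`, and the power
  -- `q = p ^ k` is a `k`-fold iterate of the additive `p`-th power.
  q-additive : Additive q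
  q-additive = let p , k , pr , _ , q≡pᵏ = q-primePower in
    ≡.subst Additive (≡.sym q≡pᵏ) (additive-^ (additive-prime pr
      (prime-characteristic (k ℕ.* n)
        (≡.trans (≡.cong (ℕ._^ n) q≡pᵏ) (ℕₚ.^-*-assoc p k n)))) k)

  -- The equational form of membership in the base field; `base⇒fixed` and `fixed⇒base` show that
  -- the two agree.
  Fixed : Carrier → Set ℓb
  Fixed x = x ^ q ≈ x

  ^qʲ⁺¹ : ∀ x j → x ^ (q ℕ.^ suc j) ≈ (x ^ (q ℕ.^ j)) ^ q
  ^qʲ⁺¹ x j = trans (^-congʳ x (ℕₚ.*-comm q (q ℕ.^ j))) (sym (^-assocʳ x (q ℕ.^ j) q))

  fixed-^qʲ : ∀ {x} → Fixed x → ∀ j → x ^ (q ℕ.^ j) ≈ x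
  fixed-^qʲ {x} fx zero    = *-identityʳ x
  fixed-^qʲ {x} fx (suc j) = trans (^qʲ⁺¹ x j) (trans (^-congˡ q (fixed-^qʲ fx j)) fx)

  fixed-* : ∀ {x y} → Fixed x → Fixed y → Fixed (x * y)
  fixed-* {x} {y} fx fy = trans (^-distrib-* x y q) (*-cong fx fy)

  fixed-neg : ∀ {x} → Fixed x → Fixed (- x)
  fixed-neg {x} fx = trans (-‿^ q-additive x) (-‿cong fx)

  ^qʲ-minus : ∀ j x y → (x - y) ^ (q ℕ.^ j) ≈ x ^ (q ℕ.^ j) - y ^ (q ℕ.^ j)
  ^qʲ-minus j x y = trans (^-distrib-+ qʲ-additive x (- y)) (+-congˡ (-‿^ qʲ-additive y))
    where qʲ-additive = additive-^ q-additive j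

  embed-^ : ∀ c k → embed (c F.^ k) ≈ embed c ^ k
  embed-^ c zero    = 1#-homo
  embed-^ c (suc k) = trans (*-homo c (c F.^ k)) (*-congˡ (embed-^ c k))

  base⇒fixed : ∀ {x} → InBaseField x → Fixed x
  base⇒fixed {x} (c , embed-c≈x) = begin
    x ^ q           ≈⟨ ^-congˡ q embed-c≈x ⟨
    embed c ^ q     ≈⟨ embed-^ c q ⟨
    embed (c F.^ q) ≈⟨ embed-cong (fermat baseField base-cardinality c) ⟩
    embed c         ≈⟨ embed-c≈x ⟩
    x               ∎

  -- If `c - d` had an inverse `y`, then `c * y = 1 + d * y`; as `c` and `d` have the same image,
  -- applying `embed` would give `1# = 0#` in the top field.
  embed-injective : ∀ {c d} → embed c ≈ embed d → c F.≈ d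
  embed-injective {c} {d} eq with F.zero-or-unit (c F.- d)
  ... | inj₁ c-d≈0 = F.x∙y⁻¹≈ε⇒x≈y c d c-d≈0
  ... | inj₂ (y , [c-d]y≈1) = contradiction 1≈0 1≉0
    where
    cy≈1+dy : c F.* y F.≈ F.1# F.+ d F.* y
    cy≈1+dy = F.trans (F.sym (F.//-rightDividesˡ (d F.* y) (c F.* y)))
      (F.+-congʳ (F.trans (F.sym (F.[y-z]x≈yx-zx y c d)) [c-d]y≈1))
    1≈0 : 1# ≈ 0#
    1≈0 = +-identityˡ-unique 1# (embed d * embed y) (begin
      1# + embed d * embed y             ≈⟨ +-cong 1#-homo (*-homo d y) ⟨
      embed F.1# + embed (d F.* y)       ≈⟨ +-homo F.1# (d F.* y) ⟨
      embed (F.1# F.+ d F.* y)           ≈⟨ embed-cong cy≈1+dy ⟨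
      embed (c F.* y)                    ≈⟨ *-homo c y ⟩
      embed c * embed y                  ≈⟨ *-congʳ eq ⟩
      embed d * embed y                  ∎)

  -- The `q` images of base elements are distinct roots of `X^q - X`; an `x` outside them would be
  -- one root too many.
  fixed⇒base : ∀ {x} → Fixed x → InBaseField x
  fixed⇒base {x} fx with any? (λ j → embed (F.from j) ≟ x)
  ... | yes (j , eq) = F.from j , eq
  ... | no x∉base = contradiction r-fixed (too-many-fixed-points (primePower⇒2≤ q-primePower) r r-injective)
    where
    r : Fin (suc q) → Carrier
    r zero    = x
    r (suc j) = embed (F.from j)

    r-injective : Injective _≡_ _≈_ r
    r-injective {zero}  {zero}  _  = ≡.refl
    r-injective {zero}  {suc j} eq = contradiction (j , sym eq) x∉base
    r-injective {suc i} {zero}  eq = contradiction (i , eq) x∉base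
    r-injective {suc i} {suc j} eq = ≡.cong suc (F.from-injective (embed-injective eq))

    r-fixed : ∀ i → Fixed (r i)
    r-fixed zero    = fx
    r-fixed (suc j) = base⇒fixed (F.from j , refl)

  Tr-cong : ∀ {x y} → x ≈ y → Tr x ≈ Tr y
  Tr-cong x≈y = sum-cong-≋ {n} λ j → ^-congˡ (q ℕ.^ toℕ j) x≈y

  Tr-+ : ∀ x y → Tr (x + y) ≈ Tr x + Tr y
  Tr-+ x y = trans
    (sum-cong-≋ {n} λ j → ^-distrib-+ (additive-^ q-additive (toℕ j)) x y)
    (∑-distrib-+ {n} (λ j → x ^ (q ℕ.^ toℕ j)) (λ j → y ^ (q ℕ.^ toℕ j)))

  Tr-* : ∀ {c} → Fixed c → ∀ x → Tr (c * x) ≈ c * Tr x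
  Tr-* {c} fc x = trans
    (sum-cong-≋ {n} λ j →
      trans (^-distrib-* c x (q ℕ.^ toℕ j)) (*-congʳ (fixed-^qʲ fc (toℕ j))))
    (sym (*-distribˡ-sum {n} c (λ j → x ^ (q ℕ.^ toℕ j))))

  -- Both sides are `t 0 + ⋯ + t k`, with the first or the last term split off.
  sum-shift : ∀ (t : ℕ → Carrier) k →
              t 0 + sum {k} (t ∘ suc ∘ toℕ) ≈ sum {k} (t ∘ toℕ) + t k
  sum-shift t zero    = +-comm (t 0) 0#
  sum-shift t (suc k) = trans (+-congˡ (sum-shift (t ∘ suc) k)) (sym (+-assoc _ _ _))

  -- Raising to the power q shifts the terms x, x^q, …, x^(q^(n-1)) cyclically, as x^(q^n) = x.
  sum-^q : ∀ x → sum {n} (λ j → (x ^ (q ℕ.^ toℕ j)) ^ q) ≈ Tr x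
  -- `x ^ 1` is the term `j = 0` of the trace, since `q ^ 0` reduces to 1. Adding it makes
  -- `sum-shift` applicable.
  sum-^q x = +-cancelˡ (x ^ 1) _ _ (begin
    x ^ 1 + sum {n} (λ j → (x ^ (q ℕ.^ toℕ j)) ^ q)
      ≈⟨ +-congˡ (sum-cong-≋ {n} λ j → ^qʲ⁺¹ x (toℕ j)) ⟨
    x ^ 1 + sum {n} (λ j → x ^ (q ℕ.^ suc (toℕ j)))
      ≈⟨ sum-shift (λ j → x ^ (q ℕ.^ j)) n ⟩
    Tr x + x ^ (q ℕ.^ n)
      ≈⟨ +-comm _ _ ⟩
    x ^ (q ℕ.^ n) + Tr x
      ≈⟨ +-congʳ (trans (fermat topField top-cardinality x) (sym (*-identityʳ x))) ⟩
    x ^ 1 + Tr x ∎)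

  Tr-fixed : ∀ x → Fixed (Tr x)
  Tr-fixed x = trans (sum-^ q-additive {n} (λ j → x ^ (q ℕ.^ toℕ j))) (sum-^q x)

  Tr-^q : ∀ x → Tr (x ^ q) ≈ Tr x
  Tr-^q x = trans
    (sum-cong-≋ {n} λ j → trans (^-assocʳ x q (q ℕ.^ toℕ j)) (^qʲ⁺¹ x (toℕ j)))
    (sum-^q x)

  Tr-^qⁱ : ∀ i x → Tr (x ^ (q ℕ.^ i)) ≈ Tr x
  Tr-^qⁱ zero    x = Tr-cong (*-identityʳ x)
  Tr-^qⁱ (suc i) x = trans (Tr-cong (^qʲ⁺¹ x i)) (trans (Tr-^q (x ^ (q ℕ.^ i))) (Tr-^qⁱ i x))

  -- The easy direction of the additive Hilbert 90, for the `i`-th iterate of the Frobenius map.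
  Tr[x-x^qⁱ]≈0 : ∀ i x → Tr (x - x ^ (q ℕ.^ i)) ≈ 0#
  Tr[x-x^qⁱ]≈0 i x = +-identityˡ-unique _ (Tr x) (begin
    Tr (x - x ^ r) + Tr x          ≈⟨ +-congˡ (Tr-^qⁱ i x) ⟨
    Tr (x - x ^ r) + Tr (x ^ r)    ≈⟨ Tr-+ _ _ ⟨
    Tr ((x - x ^ r) + x ^ r)       ≈⟨ Tr-cong (//-rightDividesˡ (x ^ r) x) ⟩
    Tr x                           ∎)
    where r = q ℕ.^ i

  x²-xʳ⁺¹≈x[x-xʳ] : ∀ x r → x ^ 2 - x ^ (r ℕ.+ 1) ≈ x * (x - x ^ r)
  x²-xʳ⁺¹≈x[x-xʳ] x r = begin
    x ^ 2 - x ^ (r ℕ.+ 1) ≈⟨ +-cong (*-congˡ (*-identityʳ x))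
                               (-‿cong (^-congʳ x (ℕₚ.+-comm r 1))) ⟩
    x * x - x * x ^ r     ≈⟨ x[y-z]≈xy-xz x x (x ^ r) ⟨
    x * (x - x ^ r)       ∎

  -- Permutations from `γ` in the base field.

  module _ (i : ℕ) where

    private
      r = q ℕ.^ i

    g : Carrier → Carrier
    g x = Tr (x ^ 2 - x ^ (r ℕ.+ 1))

    g-cong : ∀ {x y} → x ≈ y → g x ≈ g y
    g-cong x≈y = Tr-cong (+-cong (^-congˡ 2 x≈y) (-‿cong (^-congˡ (r ℕ.+ 1) x≈y)))

    g-invariant : ∀ {c} → Fixed c → ∀ x → g (x + c) ≈ g x
    g-invariant {c} fc x = begin
      g (x + c)                                  ≈⟨ Tr-cong (x²-xʳ⁺¹≈x[x-xʳ] (x + c) r) ⟩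
      Tr ((x + c) * ((x + c) - (x + c) ^ r))     ≈⟨ Tr-cong (*-congˡ shift-invariant) ⟩
      Tr ((x + c) * (x - x ^ r))                 ≈⟨ Tr-cong (distribʳ _ x c) ⟩
      Tr (x * (x - x ^ r) + c * (x - x ^ r))     ≈⟨ Tr-+ _ _ ⟩
      Tr (x * (x - x ^ r)) + Tr (c * (x - x ^ r)) ≈⟨ +-cong (Tr-cong (sym (x²-xʳ⁺¹≈x[x-xʳ] x r))) (Tr-* fc _) ⟩
      g x + c * Tr (x - x ^ r)                   ≈⟨ +-congˡ (*-congˡ (Tr[x-x^qⁱ]≈0 i x)) ⟩
      g x + c * 0#                               ≈⟨ +-congˡ (zeroʳ c) ⟩
      g x + 0#                                   ≈⟨ +-identityʳ (g x) ⟩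
      g x                                        ∎
      where
      shift-invariant : (x + c) - (x + c) ^ r ≈ x - x ^ r
      shift-invariant = begin
        (x + c) - (x + c) ^ r          ≈⟨ +-congˡ (-‿cong (trans (^-distrib-+ (additive-^ q-additive i) x c)
                                                                (+-congˡ (fixed-^qʲ fc i)))) ⟩
        (x + c) - (x ^ r + c)          ≈⟨ +-congˡ (-‿+-comm (x ^ r) c) ⟨
        (x + c) + (- (x ^ r) - c)      ≈⟨ interchange x c _ _ ⟩
        (x - x ^ r) + (c - c)          ≈⟨ +-congˡ (-‿inverseʳ c) ⟩
        (x - x ^ r) + 0#               ≈⟨ +-identityʳ _ ⟩
        x - x ^ r                      ∎

    -- `f` and `f⁻¹` move a point by `h` and `- h`, both fixed elements, so `h` has the same value
    -- before and after the move and the two maps undo each other.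
    base⇒permutes : ∀ {γ} → InBaseField γ → Permutes (λ x → x + γ * g x)
    base⇒permutes {γ} γ∈F = inverseᵇ⇒bijective
      ((λ {y} eq → trans (f-cong eq) (f∘f⁻¹ y)) , (λ {x} eq → trans (f⁻¹-cong eq) (f⁻¹∘f x)))
      where
      open Consequences setoid setoid using (inverseᵇ⇒bijective)

      h : Carrier → Carrier
      h x = γ * g x

      f f⁻¹ : Carrier → Carrier
      f x   = x + h x
      f⁻¹ y = y - h y

      h-cong : ∀ {x y} → x ≈ y → h x ≈ h y
      h-cong x≈y = *-congˡ (g-cong x≈y)

      f-cong : Congruent _≈_ _≈_ f
      f-cong x≈y = +-cong x≈y (h-cong x≈y)

      f⁻¹-cong : Congruent _≈_ _≈_ f⁻¹
      f⁻¹-cong x≈y = +-cong x≈y (-‿cong (h-cong x≈y))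

      h-fixed : ∀ x → Fixed (h x)
      h-fixed x = fixed-* (base⇒fixed γ∈F) (Tr-fixed _)

      f∘f⁻¹ : ∀ y → f (f⁻¹ y) ≈ y
      f∘f⁻¹ y = trans (+-congˡ (*-congˡ (g-invariant (fixed-neg (h-fixed y)) y)))
                      (//-rightDividesˡ (h y) y)

      f⁻¹∘f : ∀ x → f⁻¹ (f x) ≈ x
      f⁻¹∘f x = trans (+-congˡ (-‿cong (*-congˡ (g-invariant (h-fixed x) x))))
                      (//-rightDividesʳ (h x) x)

-- Degree two: permutation forces `γ` into the base field.

module QuadraticExtension {a ℓa ra b ℓb rb} {q : ℕ} (q-primePower : IsPrimePower q)
  (E : FiniteFieldExtension q 2 a ℓa ra b ℓb rb) where

  open FiniteFieldExtension E hiding (zero; _^_)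
  open RingProperties ring
  open Exp commutativeSemiring
  open AdditivePowers (fieldRing topField)
  open FiniteField topField top-cardinality
  open TraceProperties q-primePower E
  open ≈-Reasoning setoid

  -- It vanishes exactly on the base field, so `δ γ` is the obstruction to `γ` lying there.
  δ : Carrier → Carrier
  δ x = x - x ^ q

  -- In degree two the Frobenius map is an involution and swaps `x` with `x ^ q`.
  δ-^q : ∀ x → δ x ^ q ≈ - δ x
  δ-^q x = begin
    (x - x ^ q) ^ q         ≈⟨ ^-distrib-+ q-additive x (- (x ^ q)) ⟩
    x ^ q + (- (x ^ q)) ^ q ≈⟨ +-congˡ (-‿^ q-additive (x ^ q)) ⟩
    x ^ q - (x ^ q) ^ q     ≈⟨ +-congˡ (-‿cong [x^q]^q≈x) ⟩
    x ^ q - x               ≈⟨ ⁻¹-anti-homo-// x (x ^ q) ⟨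
    - δ x                   ∎
    where
    [x^q]^q≈x : (x ^ q) ^ q ≈ x
    -- `q ℕ.^ 2` unfolds to `q * (q * 1)`, hence the adjusted exponent.
    [x^q]^q≈x = trans (^-assocʳ x q q) (trans (^-congʳ x (≡.cong (q ℕ.*_) (≡.sym (ℕₚ.*-identityʳ q))))
      (fermat topField top-cardinality x))

  -x*-y≈x*y : ∀ x y → - x * - y ≈ x * y
  -x*-y≈x*y x y = begin
    - x * - y     ≈⟨ -‿distribˡ-* x (- y) ⟨
    - (x * - y)   ≈⟨ -‿cong (-‿distribʳ-* x y) ⟨
    - - (x * y)   ≈⟨ -‿involutive (x * y) ⟩
    x * y         ∎

  -- The trace is `y + y ^ q` for `y = x * δ x`. As the Frobenius map negates `δ x`, the factor
  -- `δ x` can be taken out and leaves `x - x ^ q`.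
  g≈δ² : ∀ x → Tr (x ^ 2 - x ^ (q ℕ.+ 1)) ≈ δ x * δ x
  g≈δ² x = begin
    Tr (x ^ 2 - x ^ (q ℕ.+ 1))            ≈⟨ Tr-cong (x²-xʳ⁺¹≈x[x-xʳ] x q) ⟩
    y ^ 1 + (y ^ (q ℕ.* 1) + 0#)          ≈⟨ +-cong (*-identityʳ y) (+-identityʳ _) ⟩
    y + y ^ (q ℕ.* 1)                     ≈⟨ +-congˡ (^-congʳ y (ℕₚ.*-identityʳ q)) ⟩
    x * δ x + (x * δ x) ^ q               ≈⟨ +-congˡ (^-distrib-* x (δ x) q) ⟩
    x * δ x + x ^ q * δ x ^ q             ≈⟨ +-congˡ (*-congˡ (δ-^q x)) ⟩
    x * δ x + x ^ q * - δ x               ≈⟨ +-congˡ (-‿distribʳ-* (x ^ q) (δ x)) ⟨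
    x * δ x - x ^ q * δ x                 ≈⟨ [y-z]x≈yx-zx (δ x) x (x ^ q) ⟨
    δ x * δ x                             ∎
    where y = x * δ x

  δ-* : ∀ {s} → Fixed s → ∀ x → δ (x * s) ≈ δ x * s
  δ-* {s} fs x = begin
    x * s - (x * s) ^ q     ≈⟨ +-congˡ (-‿cong (trans (^-distrib-* x s q) (*-congˡ fs))) ⟩
    x * s - x ^ q * s       ≈⟨ [y-z]x≈yx-zx s x (x ^ q) ⟨
    δ x * s                 ∎

  -- The `q`-th power of `w * t = 1` reads `- w * t ^ q = 1`; cancelling `w` gives the claim.
  unit-inverse-^q : ∀ {w t} → w * t ≈ 1# → w ^ q ≈ - w → t ^ q ≈ - t
  unit-inverse-^q {w} {t} wt≈1 w^q≈-w = sym (unit-cancelˡ (trans (*-comm t w) wt≈1) (begin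
    w * - t        ≈⟨ -‿distribʳ-* w t ⟨
    - (w * t)      ≈⟨ -‿cong wt≈1 ⟩
    - 1#           ≈⟨ -‿cong (1^ q) ⟨
    - (1# ^ q)     ≈⟨ -‿cong (^-congˡ q wt≈1) ⟨
    - ((w * t) ^ q)   ≈⟨ -‿cong (^-distrib-* w t q) ⟩
    - (w ^ q * t ^ q) ≈⟨ -‿cong (*-congʳ w^q≈-w) ⟩
    - (- w * t ^ q)   ≈⟨ -‿cong (-‿distribˡ-* w (t ^ q)) ⟨
    - - (w * t ^ q)   ≈⟨ -‿involutive _ ⟩
    w * t ^ q         ∎))
    where
    1^ : ∀ k → 1# ^ k ≈ 1#
    1^ zero    = refl
    1^ (suc k) = trans (*-identityˡ _) (1^ k)

  module _ {γ : Carrier} where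

    f : Carrier → Carrier
    f x = x + γ * Tr (x ^ 2 - x ^ (q ℕ.+ 1))

    -- `δ` is linear over fixed elements, so along the multiples `γ * s` the map is `γ` times a
    -- quadratic polynomial in `s`. Its second root provides the collision with `f 0#`.
    f[γs] : ∀ {s} → Fixed s → f (γ * s) ≈ γ * (s + (δ γ * s) * (δ γ * s))
    f[γs] {s} fs = begin
      γ * s + γ * Tr ((γ * s) ^ 2 - (γ * s) ^ (q ℕ.+ 1)) ≈⟨ +-congˡ (*-congˡ (g≈δ² (γ * s))) ⟩
      γ * s + γ * (δ (γ * s) * δ (γ * s))                ≈⟨ +-congˡ (*-congˡ (*-cong (δ-* fs γ) (δ-* fs γ))) ⟩
      γ * s + γ * ((δ γ * s) * (δ γ * s))                ≈⟨ distribˡ γ s _ ⟨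
      γ * (s + (δ γ * s) * (δ γ * s))                    ∎

    f0≈0 : f 0# ≈ 0#
    f0≈0 = begin
      0# + γ * Tr (0# ^ 2 - 0# ^ (q ℕ.+ 1)) ≈⟨ +-identityˡ _ ⟩
      γ * Tr (0# ^ 2 - 0# ^ (q ℕ.+ 1))      ≈⟨ *-congˡ (g≈δ² 0#) ⟩
      γ * (δ 0# * δ 0#)                     ≈⟨ *-congˡ (*-congʳ δ0≈0) ⟩
      γ * (0# * δ 0#)                       ≈⟨ *-congˡ (zeroˡ _) ⟩
      γ * 0#                                ≈⟨ zeroʳ γ ⟩
      0#                                    ∎
      where
      δ0≈0 : δ 0# ≈ 0#
      δ0≈0 = trans (+-congˡ (-‿cong (0^ q-additive))) (-‿inverseʳ 0#)

    -- If `δ γ` is a unit, injectivity gives `γ * s = 0#` with `s` nonzero, so `γ = 0#`. That is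
    -- already a base element, so this case ends in the goal and not in a contradiction.
    permutes⇒base : Permutes f → InBaseField γ
    permutes⇒base (f-injective , _) with zero-or-unit (δ γ)
    ... | inj₁ δγ≈0 = fixed⇒base (sym (x∙y⁻¹≈ε⇒x≈y γ (γ ^ q) δγ≈0))
    ... | inj₂ (t , wt≈1) = base-zero (*-cancelˡ-≉0 s≉0 (begin
        s * γ   ≈⟨ *-comm s γ ⟩
        γ * s   ≈⟨ f-injective f[γs]≈f0 ⟩
        0#      ≈⟨ zeroʳ s ⟨
        s * 0#  ∎))
      where
      w = δ γ
      s = - (t * t)

      base-zero : γ ≈ 0# → InBaseField γ
      base-zero γ≈0 = fixed⇒base (trans (^-congˡ q γ≈0) (trans (0^ q-additive) (sym γ≈0)))

      t^q≈-t : t ^ q ≈ - t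
      t^q≈-t = unit-inverse-^q wt≈1 (δ-^q γ)

      -- The Frobenius map negates `w` and therefore its inverse `t`; the signs cancel in `t * t`.
      s-fixed : Fixed s
      s-fixed = fixed-neg (trans (^-distrib-* t t q)
        (trans (*-cong t^q≈-t t^q≈-t) (-x*-y≈x*y t t)))

      ws≈-t : w * s ≈ - t
      ws≈-t = begin
        w * - (t * t)   ≈⟨ -‿distribʳ-* w (t * t) ⟨
        - (w * (t * t)) ≈⟨ -‿cong (*-assoc w t t) ⟨
        - ((w * t) * t) ≈⟨ -‿cong (*-congʳ wt≈1) ⟩
        - (1# * t)      ≈⟨ -‿cong (*-identityˡ t) ⟩
        - t             ∎

      s≉0 : ¬ (s ≈ 0#)
      s≉0 s≈0 = 1≉0 (begin
        1#        ≈⟨ wt≈1 ⟨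
        w * t     ≈⟨ *-congˡ (-‿involutive t) ⟨
        w * - - t ≈⟨ *-congˡ (-‿cong ws≈-t) ⟨
        w * - (w * s) ≈⟨ *-congˡ (-‿cong (trans (*-congˡ s≈0) (zeroʳ w))) ⟩
        w * - 0#  ≈⟨ *-congˡ -0#≈0# ⟩
        w * 0#    ≈⟨ zeroʳ w ⟩
        0#        ∎)

      f[γs]≈f0 : f (γ * s) ≈ f 0#
      f[γs]≈f0 = begin
        f (γ * s)                        ≈⟨ f[γs] s-fixed ⟩
        γ * (s + (w * s) * (w * s))      ≈⟨ *-congˡ (+-congˡ (*-cong ws≈-t ws≈-t)) ⟩
        γ * (s + - t * - t)              ≈⟨ *-congˡ (+-congˡ (-x*-y≈x*y t t)) ⟩
        γ * (s + t * t)                  ≈⟨ *-congˡ (-‿inverseˡ (t * t)) ⟩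
        γ * 0#                           ≈⟨ zeroʳ γ ⟩
        0#                               ≈⟨ f0≈0 ⟨
        f 0#                             ∎

  -- The case `i = 1`, where `q ^ 1` unfolds to `q * 1` and has to be transported to `q`.
  base⇒permutes₂ : ∀ {γ} → InBaseField γ → Permutes (f {γ})
  base⇒permutes₂ {γ} = ≡.subst
    (λ r → InBaseField γ → Permutes (λ x → x + γ * Tr (x ^ 2 - x ^ (r ℕ.+ 1))))
    (ℕₚ.*-identityʳ q) (base⇒permutes 1)

theorem3p5 : ∀ {a ℓa ra b ℓb rb} →
    ( (q n i : ℕ) → IsPrimePower q → 1 ≤ n → 1 ≤ i → i ≤ n ∸ 1 →
    (E : FiniteFieldExtension q n a ℓa ra b ℓb rb) →
    let open FiniteFieldExtension E in
    (γ : Carrier) → InBaseField γ →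
    Permutes (λ x → x + γ * Tr (x ^ 2 - x ^ (q ℕ.^ i ℕ.+ 1))) )
    ×
    ( (q : ℕ) → IsPrimePower q → ¬ (2 ∣ q) →
    (E : FiniteFieldExtension q 2 a ℓa ra b ℓb rb) →
    let open FiniteFieldExtension E in
    (γ : Carrier) →
    Permutes (λ x → x + γ * Tr (x ^ 2 - x ^ (q ℕ.+ 1))) ⇔ InBaseField γ )
theorem3p5 =
    (λ q n i q-pp _ _ _ E γ → TraceProperties.base⇒permutes q-pp E i)
  , (λ q q-pp _ E γ → let open QuadraticExtension q-pp E in
      mk⇔ permutes⇒base base⇒permutes₂)
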